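{- Let $(G,\gamma)$ be an edge-colored simple graph with $n>2$ vertices, $m$ edges, and $\ell$ colors. (1) The smallest possible number of colors is $\ell=1$. In this case, $\operatorname{wld}(G)=0$. (2) If $\ell=2$, then $\operatorname{wld}(G)=\kappa(G_1)+\kappa(G_2)-2$. (3) If $\ell=m-1>1$, then \[\operatorname{wld}(G)=\begin{cases}1 & \text{if } n=3,\\ n-1 & \text{if } n>3.\end{cases}\] (4) The largest possible number of colors is $\ell=m$. In this case, $\operatorname{wld}(G)=n-1$.
   Context: An edge-colored graph $(G,\gamma)$ is a finite connected graph $G$ with a surjective function $\gamma:E(G)\to\mathcal{C}=\{c_1,\dots,c_\ell\}$ onto a finite set of colors (not necessarily a proper edge-coloring). For each color $c_i$ let $E_i(G)=\{e\in E(G):\gamma(e)=c_i\}$ and let $G_i$ be the graph with vertex set $V(G)$ and edge set $E_i(G)$; $\kappa(G_i)$ is its number of connected components. For $W\subseteq E(G)$, let $G_i^W$ be the graph with vertex set $V(G)$ and edge set $W\cup E_i(G)$. The set $W$ is color-connecting if $G_i^W$ is connected for every color $c_i\in\mathcal{C}$. The wild number $\operatorname{wld}(G)$ is the minimum size of a color-connecting set. -}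

module Defs where

open import Data.Bool.Base using (true; false)
open import Data.Empty using (⊥-elim)
open import Data.Fin.Base using (Fin; zero; suc)
open import Data.Fin.Properties using (_≟_; all?; any?; suc-injective)
open import Data.Fin.Subset using (Subset; _∈_; _∪_; ∣_∣; ⊤)
open import Data.Fin.Subset.Properties using (anySubset?; p⊆p∪q)
open import Data.Nat.Base using (ℕ; zero; suc; _≤_; z≤n; s≤s)
import Data.Nat.Properties as ℕ
open import Data.Product.Base using (∃; _×_; _,_; proj₁; proj₂)
open import Data.Sum.Base using (_⊎_; inj₁; inj₂; swap)
open import Data.Vec.Base using (tabulate; []; _∷_; here; there)
open import Function.Base using (_∘_)
open import Function.Bundles using (Bijection; Surjection; _↠_)
open import Level using (0ℓ)
open import Relation.Binary.Bundles using (Setoid)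
open import Relation.Binary.Core using (Rel)
open import Relation.Binary.Construct.Closure.ReflexiveTransitive
  using (Star; ε; _◅_; _◅◅_; reverse) renaming (map to mapStar)
import Relation.Binary.Construct.On as On
open import Relation.Binary.Definitions using (Decidable)
open import Relation.Binary.PropositionalEquality as ≡ using (_≡_; refl)
open import Relation.Binary.Structures using (IsEquivalence)
open import Relation.Nullary.Decidable using (Dec; yes; no; does; map′; _×-dec_; _⊎-dec_)
open import Relation.Nullary.Negation using (¬_)
import Relation.Unary as U

IsMinimum : (ℕ → Set) → ℕ → Set
IsMinimum P k = P k × (∀ {j} → P j → k ≤ j)

IsMaximum : (ℕ → Set) → ℕ → Set
IsMaximum P k = P k × (∀ {j} → P j → j ≤ k)

-- A finite undirected multigraph with vertex set Fin n and edge set Fin m; the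
-- order of the two endpoints carries no information (see Joins).
record Graph (n m : ℕ) : Set where
  constructor mkGraph
  field
    endpoints : Fin m → Fin n × Fin n

open Graph public

Joins : ∀ {n m} → Graph n m → Fin m → Rel (Fin n) 0ℓ
Joins G e u v = (endpoints G e ≡ (u , v)) ⊎ (endpoints G e ≡ (v , u))

Simple : ∀ {n m} → Graph n m → Set
Simple G = (∀ e u → ¬ Joins G e u u)
         × (∀ e f u v → Joins G e u v → Joins G f u v → e ≡ f)

-- A set S of edges stands for the spanning subgraph with all vertices of G and
-- edge set S; in particular ⊤ stands for G itself.
Adjacent : ∀ {n m} → Graph n m → Subset m → Rel (Fin n) 0ℓ
Adjacent G S u v = ∃ λ e → e ∈ S × Joins G e u v

Reachable : ∀ {n m} → Graph n m → Subset m → Rel (Fin n) 0ℓ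
Reachable G S = Star (Adjacent G S)

-- For n = 0 this holds vacuously.
Connected : ∀ {n m} → Graph n m → Subset m → Set
Connected G S = ∀ u v → Reachable G S u v

Reachable-isEquivalence : ∀ {n m} (G : Graph n m) (S : Subset m) →
                          IsEquivalence (Reachable G S)
Reachable-isEquivalence G S = record
  { refl = ε
  ; sym = reverse λ (e , e∈S , j) → e , e∈S , swap j
  ; trans = _◅◅_
  }

-- Vertices up to reachability, i.e. the connected components.
Components : ∀ {n m} → Graph n m → Subset m → Setoid 0ℓ 0ℓ
Components G S = record { isEquivalence = Reachable-isEquivalence G S }

HasCardinality : Setoid 0ℓ 0ℓ → ℕ → Set
HasCardinality A k = Bijection A (≡.setoid (Fin k))

-- Reachability is decided by adding the edges one at a time.
private
  dropEdge : ∀ {n m} → Graph n (suc m) → Graph n m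
  dropEdge G = mkGraph (endpoints G ∘ suc)

  weaken : ∀ {n m} (G : Graph n (suc m)) {s S u v} →
           Reachable (dropEdge G) S u v → Reachable G (s ∷ S) u v
  weaken G = mapStar λ (e , e∈S , j) → suc e , there e∈S , j

  Split : ∀ {n m} → Graph n (suc m) → Subset m → Rel (Fin n) 0ℓ
  Split G S u v =
    let R = Reachable (dropEdge G) S
        a = proj₁ (endpoints G zero)
        b = proj₂ (endpoints G zero)
    in R u v ⊎ (R u a × R b v) ⊎ (R u b × R a v)

  split : ∀ {n m} (G : Graph n (suc m)) {s S u v} →
          Reachable G (s ∷ S) u v → Split G S u v
  split G ε = inj₁ ε
  split G ((suc e , there e∈S , j) ◅ p) with split G p
  ... | inj₁ q = inj₁ ((e , e∈S , j) ◅ q)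
  ... | inj₂ (inj₁ (q , r)) = inj₂ (inj₁ ((e , e∈S , j) ◅ q , r))
  ... | inj₂ (inj₂ (q , r)) = inj₂ (inj₂ ((e , e∈S , j) ◅ q , r))
  split G ((zero , here , inj₁ refl) ◅ p) with split G p
  ... | inj₁ q = inj₂ (inj₁ (ε , q))
  ... | inj₂ (inj₁ (_ , r)) = inj₂ (inj₁ (ε , r))
  ... | inj₂ (inj₂ (_ , r)) = inj₁ r
  split G ((zero , here , inj₂ refl) ◅ p) with split G p
  ... | inj₁ q = inj₂ (inj₂ (ε , q))
  ... | inj₂ (inj₁ (_ , r)) = inj₁ r
  ... | inj₂ (inj₂ (_ , r)) = inj₂ (inj₂ (ε , r))

  unsplit : ∀ {n m} (G : Graph n (suc m)) {S u v} →
            Split G S u v → Reachable G (true ∷ S) u v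
  unsplit G (inj₁ p) = weaken G p
  unsplit G (inj₂ (inj₁ (p , q))) =
    weaken G p ◅◅ (zero , here , inj₁ refl) ◅ weaken G q
  unsplit G (inj₂ (inj₂ (p , q))) =
    weaken G p ◅◅ (zero , here , inj₂ refl) ◅ weaken G q

  strengthen : ∀ {n m} (G : Graph n (suc m)) {S u v} →
               Reachable G (false ∷ S) u v → Reachable (dropEdge G) S u v
  strengthen G ε = ε
  strengthen G ((suc e , there e∈S , j) ◅ p) = (e , e∈S , j) ◅ strengthen G p

reachable? : ∀ {n m} (G : Graph n m) (S : Subset m) → Decidable (Reachable G S)
reachable? G [] u v with u ≟ v
... | yes refl = yes ε
... | no u≢v = no λ { ε → u≢v refl ; ((() , _) ◅ _) }
reachable? G (false ∷ S) u v =
  map′ (weaken G) (strengthen G) (reachable? (dropEdge G) S u v)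
reachable? G (true ∷ S) u v = map′ (unsplit G) (split G)
  (R? u v ⊎-dec ((R? u a ×-dec R? b v) ⊎-dec (R? u b ×-dec R? a v)))
  where
  R? = reachable? (dropEdge G) S
  a = proj₁ (endpoints G zero)
  b = proj₂ (endpoints G zero)

connected? : ∀ {n m} (G : Graph n m) (S : Subset m) → Dec (Connected G S)
connected? G S = all? λ u → all? λ v → reachable? G S u v

finiteQuotient : ∀ {n} {_~_ : Rel (Fin n) 0ℓ} (equiv : IsEquivalence _~_) →
                 Decidable _~_ →
                 ∃ (HasCardinality (record { isEquivalence = equiv }))
finiteQuotient {zero} equiv _~?_ = 0 , record
  { to = λ ()
  ; cong = λ { {()} }
  ; bijective = (λ { {()} }) , λ ()
  }
finiteQuotient {suc n} {_~_} equiv _~?_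
  with finiteQuotient (On.isEquivalence suc equiv) (λ u v → suc u ~? suc v)
     | any? (λ v → zero ~? suc v)
... | k , c | yes (w , 0~w) = k , record
  { to = to
  ; cong = λ {u} {v} → to-cong u v
  ; bijective = (λ {u} {v} → to-inj u v) , to-surj
  }
  where
  module ~ = IsEquivalence equiv
  module c = Bijection c
  to : Fin (suc n) → Fin k
  to zero = c.to w
  to (suc u) = c.to u
  to-cong : ∀ u v → u ~ v → to u ≡ to v
  to-cong zero zero _ = refl
  to-cong zero (suc v) p = c.cong (~.trans (~.sym 0~w) p)
  to-cong (suc u) zero p = c.cong (~.trans p 0~w)
  to-cong (suc u) (suc v) p = c.cong p
  to-inj : ∀ u v → to u ≡ to v → u ~ v
  to-inj zero zero _ = ~.refl
  to-inj zero (suc v) p = ~.trans 0~w (c.injective p)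
  to-inj (suc u) zero p = ~.trans (c.injective p) (~.sym 0~w)
  to-inj (suc u) (suc v) p = c.injective p
  to-surj : ∀ y → ∃ λ x → ∀ {z} → z ~ x → to z ≡ y
  to-surj y with c.surjective y
  ... | x , h = suc x , λ {z} p → ≡.trans (to-cong z (suc x) p) (h ~.refl)
... | k , c | no ¬0~ = suc k , record
  { to = to
  ; cong = λ {u} {v} → to-cong u v
  ; bijective = (λ {u} {v} → to-inj u v) , to-surj
  }
  where
  module ~ = IsEquivalence equiv
  module c = Bijection c
  to : Fin (suc n) → Fin (suc k)
  to zero = zero
  to (suc u) = suc (c.to u)
  to-cong : ∀ u v → u ~ v → to u ≡ to v
  to-cong zero zero _ = refl
  to-cong zero (suc v) p = ⊥-elim (¬0~ (v , p))
  to-cong (suc u) zero p = ⊥-elim (¬0~ (u , ~.sym p))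
  to-cong (suc u) (suc v) p = ≡.cong suc (c.cong p)
  to-inj : ∀ u v → to u ≡ to v → u ~ v
  to-inj zero zero _ = ~.refl
  to-inj (suc u) (suc v) p = c.injective (suc-injective p)
  to-surj : ∀ y → ∃ λ x → ∀ {z} → z ~ x → to z ≡ y
  to-surj zero = zero , λ {z} → to-cong z zero
  to-surj (suc y) with c.surjective y
  ... | x , h = suc x , λ {z} p → ≡.trans (to-cong z (suc x) p) (≡.cong suc (h ~.refl))

componentCount : ∀ {n m} (G : Graph n m) (S : Subset m) →
                 ∃ (HasCardinality (Components G S))
componentCount G S =
  finiteQuotient (Reachable-isEquivalence G S) (reachable? G S)

κ : ∀ {n m} → Graph n m → Subset m → ℕ
κ G S = proj₁ (componentCount G S)

record ConnectedGraph (n m : ℕ) : Set where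
  field
    graph     : Graph n m
    connected : Connected graph ⊤

open ConnectedGraph public

-- Edge-colorings of G with exactly ℓ colors, not necessarily proper.
Coloring : ∀ {n m} → ConnectedGraph n m → ℕ → Set
Coloring {m = m} G ℓ = Fin m ↠ Fin ℓ

module _ {n m ℓ : ℕ} (G : ConnectedGraph n m) (γ : Coloring G ℓ) where

  colorClass : Fin ℓ → Subset m
  colorClass i = tabulate λ e → does (Surjection.to γ e ≟ i)

  ColorConnecting : Subset m → Set
  ColorConnecting W = ∀ i → Connected (graph G) (W ∪ colorClass i)

  ColorConnectingSize : ℕ → Set
  ColorConnectingSize w = ∃ λ W → ColorConnecting W × ∣ W ∣ ≡ w

private
  minimum : ∀ {P : ℕ → Set} → U.Decidable P → ∀ k → P k → ∃ (IsMinimum P)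
  minimum P? k p with P? 0
  ... | yes p₀ = 0 , p₀ , λ _ → z≤n
  minimum P? zero p | no ¬p₀ = ⊥-elim (¬p₀ p)
  minimum {P} P? (suc k) p | no ¬p₀ with minimum (P? ∘ suc) k p
  ... | j , pⱼ , least = suc j , pⱼ , bound
    where
    bound : ∀ {i} → P i → suc j ≤ i
    bound {zero} p₀ = ⊥-elim (¬p₀ p₀)
    bound {suc i} pᵢ = s≤s (least pᵢ)

wildNumber : ∀ {n m ℓ} (G : ConnectedGraph n m) (γ : Coloring G ℓ) →
             ∃ (IsMinimum (ColorConnectingSize G γ))
wildNumber {m = m} G γ = minimum size? ∣ ⊤ {n = m} ∣ (⊤ , connecting , refl)
  where
  size? : U.Decidable (ColorConnectingSize G γ)
  size? w = anySubset? λ W →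
    all? (λ i → connected? (graph G) (W ∪ colorClass G γ i)) ×-dec (∣ W ∣ ℕ.≟ w)
  connecting : ColorConnecting G γ ⊤
  connecting i u v = mapStar (λ (e , e∈⊤ , j) → e , p⊆p∪q _ e∈⊤ , j) (connected G u v)

wld : ∀ {n m ℓ} (G : ConnectedGraph n m) → Coloring G ℓ → ℕ
wld G γ = proj₁ (wildNumber G γ)

{-# OPTIONS --safe #-}
-- An edge e joins at most two components, so deleting it from a spanning
-- subgraph raises the number of components by at most one.  Hence joining S to a
-- connected subgraph takes at least κ(S) − 1 edges, and κ(S) − 1 suffice because
-- any connected S ∪ T contains an edge of T between two components of S.  In
-- particular a connected spanning subgraph has at least n − 1 edges.
--
-- For two colors, a color-connecting W splits into W ∩ E₂, which must connect G₁,
-- and W ∩ E₁, which must connect G₂.  For many colors, if a color-connecting W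
-- has fewer than n − 1 edges then every color has an edge outside W, so that
-- |W| ≤ m − ℓ; then W ∪ Eᵢ being connected forces |Eᵢ| ≥ n − 1 − (m − ℓ) ≥ 2 for
-- every i, so that 2ℓ ≤ m, which is impossible for ℓ ≥ 2 and ℓ ≥ m − 1.  The bound
-- n − 1 − (m − ℓ) ≥ 2 fails only for ℓ = m − 1 and n = 3, where any two edges
-- connect G, so one edge of the repeated color is color-connecting.
module Submission where

open import Algebra.Properties.CommutativeMonoid.Sum using (sum; sum-cong-≗; ∑-distrib-+; sum-replicate-zero)
open import Data.Bool.Base using (Bool; true; false)
open import Data.Fin.Base using (Fin; zero; suc; fromℕ<; punchIn; punchOut)
open import Data.Fin.Properties using (_≟_; all?; injective⇒≤; pigeonhole; punchIn-punchOut; <⇒≢)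
open import Data.Fin.Subset
open import Data.Fin.Subset.Properties
open import Data.Nat.Base using (ℕ; zero; suc; _+_; _*_; _∸_; _≤_; _<_; z≤n; s≤s; >-nonZero)
import Data.Nat.Properties as ℕ
open import Data.Product.Base using (∃; ∃₂; _×_; _,_; proj₁; proj₂)
open import Data.Product.Properties using (≡-dec)
open import Data.Sum.Base using (_⊎_; inj₁; inj₂; [_,_]′)
open import Data.Vec.Base using (tabulate; []; _∷_)
open import Data.Vec.Properties using (lookup∘tabulate; []=⇒lookup; lookup⇒[]=)
open import Function.Base using (_∘_; id)
open import Function.Bundles using (Bijection; Surjection; mk↠ₛ)
open import Function.Construct.Identity using (↠-id)
open import Level using (0ℓ)
open import Relation.Binary.Core using (Rel)
open import Relation.Binary.Construct.Closure.ReflexiveTransitive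
  using (Star; ε; _◅_; _◅◅_) renaming (map to mapStar)
open import Relation.Binary.PropositionalEquality
open import Relation.Binary.Structures using (IsEquivalence)
open import Relation.Nullary.Decidable using (yes; no; does; dec-true; toWitness; _→-dec_; ¬?; decidable-stable)
open import Relation.Nullary.Negation using (¬_; contradiction)
import Relation.Unary as U
open import Defs

-- Cardinalities of subsets

∣p∪q∣≤∣p∣+∣q∣ : ∀ {n} (p q : Subset n) → ∣ p ∪ q ∣ ≤ ∣ p ∣ + ∣ q ∣
∣p∪q∣≤∣p∣+∣q∣ [] [] = z≤n
∣p∪q∣≤∣p∣+∣q∣ (false ∷ p) (false ∷ q) = ∣p∪q∣≤∣p∣+∣q∣ p q
∣p∪q∣≤∣p∣+∣q∣ (false ∷ p) (true ∷ q) =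
  subst (suc ∣ p ∪ q ∣ ≤_) (sym (ℕ.+-suc ∣ p ∣ ∣ q ∣)) (s≤s (∣p∪q∣≤∣p∣+∣q∣ p q))
∣p∪q∣≤∣p∣+∣q∣ (true ∷ p) (false ∷ q) = s≤s (∣p∪q∣≤∣p∣+∣q∣ p q)
∣p∪q∣≤∣p∣+∣q∣ (true ∷ p) (true ∷ q) =
  s≤s (ℕ.≤-trans (∣p∪q∣≤∣p∣+∣q∣ p q) (ℕ.+-monoʳ-≤ ∣ p ∣ (ℕ.n≤1+n _)))

∣⁅x⁆∪p∣≤1+∣p∣ : ∀ {n} (x : Fin n) (p : Subset n) → ∣ ⁅ x ⁆ ∪ p ∣ ≤ suc ∣ p ∣
∣⁅x⁆∪p∣≤1+∣p∣ x p = subst (λ k → ∣ ⁅ x ⁆ ∪ p ∣ ≤ k + ∣ p ∣) (∣⁅x⁆∣≡1 x) (∣p∪q∣≤∣p∣+∣q∣ ⁅ x ⁆ p)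

-- Meant for a color class `p` and a candidate set `q`: a class not swallowed by `q` contributes at
-- least one edge to `∁ q`.
p⊈q⇒∣∁q∩p∣≥1 : ∀ {n} {p q : Subset n} → ¬ (p ⊆ q) → 1 ≤ ∣ ∁ q ∩ p ∣
p⊈q⇒∣∁q∩p∣≥1 {p = p} {q} p⊈q with nonempty? (∁ q ∩ p)
... | yes (_ , x∈) = ℕ.≤-trans (s≤s z≤n) (x∈p⇒∣p-x∣<∣p∣ x∈)
... | no none = contradiction
  (λ {x} x∈p → decidable-stable (x ∈? q) λ x∉q → none (x , x∈p∩q⁺ (x∉p⇒x∈∁p x∉q , x∈p)))
  p⊈q

-- Counting a subset fiber by fiber

∑ : ∀ {n} → (Fin n → ℕ) → ℕ
∑ = sum ℕ.+-0-commutativeMonoid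

*≤∑ : ∀ {n c} (f : Fin n → ℕ) → (∀ i → c ≤ f i) → n * c ≤ ∑ f
*≤∑ {zero} f c≤f = z≤n
*≤∑ {suc n} f c≤f = ℕ.+-mono-≤ (c≤f zero) (*≤∑ (f ∘ suc) (c≤f ∘ suc))

-- Unfolds to the same term as `colorClass`, so facts about fibers apply to color classes without
-- conversion.
fiber : ∀ {m ℓ} → (Fin m → Fin ℓ) → Fin ℓ → Subset m
fiber f i = tabulate λ e → does (f e ≟ i)

∈fiber⁺ : ∀ {m ℓ} (f : Fin m → Fin ℓ) {e i} → f e ≡ i → e ∈ fiber f i
∈fiber⁺ f {e} {i} eq =
  lookup⇒[]= e _ (trans (lookup∘tabulate _ e) (dec-true (f e ≟ i) eq))

∈fiber⁻ : ∀ {m ℓ} (f : Fin m → Fin ℓ) {e i} → e ∈ fiber f i → f e ≡ i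
∈fiber⁻ f {e} {i} e∈ with f e ≟ i | trans (sym (lookup∘tabulate (λ e → does (f e ≟ i)) e)) ([]=⇒lookup e∈)
... | yes eq | _ = eq
... | no _ | ()

⟦_⟧ : Bool → ℕ
⟦ true ⟧ = 1
⟦ false ⟧ = 0

∣b∷p∣ : ∀ {n} b (p : Subset n) → ∣ b ∷ p ∣ ≡ ⟦ b ⟧ + ∣ p ∣
∣b∷p∣ true p = refl
∣b∷p∣ false p = refl

∑-indicator : ∀ {ℓ} (j : Fin ℓ) → ∑ (λ i → ⟦ does (j ≟ i) ⟧) ≡ 1
∑-indicator {suc ℓ} zero = cong suc (sum-replicate-zero ℕ.+-0-commutativeMonoid ℓ)
∑-indicator {suc ℓ} (suc j) = ∑-indicator j

-- Every element lies in exactly one fiber, so each `true` entry adds an indicator function of total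
-- 1 to the sum.
∑-fibers : ∀ {m ℓ} (f : Fin m → Fin ℓ) (p : Subset m) →
           ∑ (λ i → ∣ p ∩ fiber f i ∣) ≡ ∣ p ∣
∑-fibers {ℓ = ℓ} f [] = sum-replicate-zero ℕ.+-0-commutativeMonoid ℓ
∑-fibers f (false ∷ p) = ∑-fibers (f ∘ suc) p
∑-fibers f (true ∷ p) = begin
  ∑ (λ i → ∣ does (f zero ≟ i) ∷ (p ∩ fiber (f ∘ suc) i) ∣)
    ≡⟨ sum-cong-≗ ℕ.+-0-commutativeMonoid (λ i → ∣b∷p∣ (does (f zero ≟ i)) (p ∩ fiber (f ∘ suc) i)) ⟩
  ∑ (λ i → ⟦ does (f zero ≟ i) ⟧ + ∣ p ∩ fiber (f ∘ suc) i ∣)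
    ≡⟨ ∑-distrib-+ ℕ.+-0-commutativeMonoid (λ i → ⟦ does (f zero ≟ i) ⟧) _ ⟩
  ∑ (λ i → ⟦ does (f zero ≟ i) ⟧) + ∑ (λ i → ∣ p ∩ fiber (f ∘ suc) i ∣)
    ≡⟨ cong₂ _+_ (∑-indicator (f zero)) (∑-fibers (f ∘ suc) p) ⟩
  suc ∣ p ∣ ∎
  where open ≡-Reasoning

-- Components of spanning subgraphs

-- Decidability of `P` locates the first step of the path that leaves `P`.
Star-crossing : ∀ {A : Set} {R : Rel A 0ℓ} {P : A → Set} → U.Decidable P →
                ∀ {x y} → Star R x y → P x → ¬ P y →
                ∃₂ λ a b → R a b × P a × ¬ P b
Star-crossing P? ε px ¬py = contradiction px ¬py
Star-crossing P? {x} (_◅_ {j = z} r p) px ¬py with P? z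
... | yes pz = Star-crossing P? p pz ¬py
... | no ¬pz = x , z , r , px , ¬pz

module _ {n m : ℕ} (G : Graph n m) where

  private
    module ~ (S : Subset m) = IsEquivalence (Reachable-isEquivalence G S)

  Reachable-mono : ∀ {S S′ u v} → S ⊆ S′ → Reachable G S u v → Reachable G S′ u v
  Reachable-mono S⊆S′ = mapStar λ (e , e∈S , j) → e , S⊆S′ e∈S , j

  Connected-mono : ∀ {S S′} → S ⊆ S′ → Connected G S → Connected G S′
  Connected-mono S⊆S′ c u v = Reachable-mono S⊆S′ (c u v)

  Reachable-⊥ : ∀ {u v} → Reachable G ⊥ u v → u ≡ v
  Reachable-⊥ ε = refl
  Reachable-⊥ ((_ , e∈⊥ , _) ◅ _) = contradiction e∈⊥ ∉⊥

  -- Cut the path after its last use of `e`: the remainder runs inside `S` and starts at an endpoint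
  -- of `e`.
  Reachable-∪⁅⁆⁻ : ∀ {S} e {u v} → let (a , b) = endpoints G e in
                   Reachable G (S ∪ ⁅ e ⁆) u v →
                   Reachable G S u v ⊎ Reachable G S a v ⊎ Reachable G S b v
  Reachable-∪⁅⁆⁻ e ε = inj₁ ε
  Reachable-∪⁅⁆⁻ {S} e ((f , f∈ , j) ◅ p) with Reachable-∪⁅⁆⁻ e p
  ... | inj₂ r = inj₂ r
  ... | inj₁ r with x∈p∪q⁻ S ⁅ e ⁆ f∈
  ... | inj₁ f∈S = inj₁ ((f , f∈S , j) ◅ r)
  ... | inj₂ f∈e with x∈⁅y⁆⇒x≡y e f∈e | j
  ... | refl | inj₁ refl = inj₂ (inj₂ r)
  ... | refl | inj₂ refl = inj₂ (inj₁ r)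

  -- A family meeting every component bounds their number from above, and a `Separated` family
  -- bounds it from below. Both can be adjusted edge by edge without recomputing `κ`.
  Covers : ∀ {k} → Subset m → (Fin k → Fin n) → Set
  Covers S g = ∀ v → ∃ λ i → Reachable G S (g i) v

  Covers-mono : ∀ {k S S′} {g : Fin k → Fin n} → S ⊆ S′ → Covers S g → Covers S′ g
  Covers-mono S⊆S′ c v with c v
  ... | i , r = i , Reachable-mono S⊆S′ r

  Separated : ∀ {k} → Subset m → (Fin k → Fin n) → Set
  Separated S g = ∀ {i j} → Reachable G S (g i) (g j) → i ≡ j

  -- Two separated vertices cannot be reached from the same covering vertex, so choosing a covering
  -- vertex for each is injective.
  Separated⇒≤Covers : ∀ {S j k} {g : Fin j → Fin n} {h : Fin k → Fin n} →
                      Separated S g → Covers S h → j ≤ k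
  Separated⇒≤Covers {S} {g = g} {h} sep cov = injective⇒≤ {f = λ i → proj₁ (cov (g i))}
    λ {i} {j} eq → sep (~.trans S (~.sym S (proj₂ (cov (g i))))
      (subst (λ k → Reachable G S (h k) (g j)) (sym eq) (proj₂ (cov (g j)))))

  κ-representatives : ∀ S → ∃ λ (g : Fin (κ G S) → Fin n) → Covers S g × Separated S g
  κ-representatives S = g , covers , separated
    where
    module B = Bijection (proj₂ (componentCount G S))
    g : Fin (κ G S) → Fin n
    g i = proj₁ (B.surjective i)
    to∘g : ∀ i → B.to (g i) ≡ i
    to∘g i = proj₂ (B.surjective i) ε
    covers : Covers S g
    covers v = B.to v , B.injective (to∘g (B.to v))
    separated : Separated S g
    separated {i} {j} r = trans (sym (to∘g i)) (trans (B.cong r) (to∘g j))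

  -- The representative of the component containing e is replaced by both
  -- endpoints of e.
  Covers-delete : ∀ {S k} e (g : Fin k → Fin n) → Covers (S ∪ ⁅ e ⁆) g →
                  ∃ λ (h : Fin (suc k) → Fin n) → Covers S h
  Covers-delete {S} {k} e g cov = h , h-cov
    where
    a = proj₁ (endpoints G e)
    b = proj₂ (endpoints G e)
    i₀ = proj₁ (cov a)
    h : Fin (suc k) → Fin n
    h zero = b
    h (suc i) with i ≟ i₀
    ... | yes _ = a
    ... | no _ = g i
    h-a : h (suc i₀) ≡ a
    h-a with i₀ ≟ i₀
    ... | yes _ = refl
    ... | no ≢ = contradiction refl ≢
    fromEdge : ∀ {v} → Reachable G S a v ⊎ Reachable G S b v → ∃ λ i → Reachable G S (h i) v
    fromEdge (inj₁ r) = suc i₀ , subst (λ x → Reachable G S x _) (sym h-a) r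
    fromEdge (inj₂ r) = zero , r
    h-old : ∀ {i} → i ≢ i₀ → h (suc i) ≡ g i
    h-old {i} ≢ with i ≟ i₀
    ... | yes ≡i₀ = contradiction ≡i₀ ≢
    ... | no _ = refl
    h-cov : Covers S h
    h-cov v with cov v
    ... | i , r with i ≟ i₀
    ... | no ≢ = [ (λ q → suc i , subst (λ x → Reachable G S x v) (sym (h-old ≢)) q) , fromEdge ]′
      (Reachable-∪⁅⁆⁻ e r)
    ... | yes refl = fromEdge
      ([ inj₁ , id ]′ (Reachable-∪⁅⁆⁻ e (~.trans _ (~.sym _ (proj₂ (cov a))) r)))

  -- Deleting the edges of `T` one by one costs at most one new covering vertex each; once `T` is
  -- empty, the two families are compared over `S`.
  Separated⇒≤∣T∣+Covers : ∀ {S T j k} {f : Fin j → Fin n} {g : Fin k → Fin n} →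
                          Separated S f → Covers (S ∪ T) g → j ≤ ∣ T ∣ + k
  Separated⇒≤∣T∣+Covers {S} {j = j} {f = f} sep = go _ ℕ.≤-refl
    where
    -- The bound `t` drives the recursion, since `T - e` is not a structural part of `T`.
    go : ∀ t {T k} {g : Fin k → Fin n} → ∣ T ∣ ≤ t → Covers (S ∪ T) g → j ≤ t + k
    go t {T} {k} ∣T∣≤t cov with nonempty? T
    ... | no empty = ℕ.≤-trans (Separated⇒≤Covers sep (Covers-mono S∪T⊆S cov)) (ℕ.m≤n+m k t)
      where
      S∪T⊆S : S ∪ T ⊆ S
      S∪T⊆S x∈ = [ id , (λ x∈T → contradiction (_ , x∈T) empty) ]′ (x∈p∪q⁻ S T x∈)
    go zero ∣T∣≤0 cov | yes (e , e∈T) =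
      contradiction (ℕ.<-≤-trans (x∈p⇒∣p-x∣<∣p∣ e∈T) ∣T∣≤0) λ ()
    go (suc t) {T} {k} {g} ∣T∣≤t cov | yes (e , e∈T) = subst (j ≤_) (ℕ.+-suc t k)
      (go t (ℕ.≤-pred (ℕ.<-≤-trans (x∈p⇒∣p-x∣<∣p∣ e∈T) ∣T∣≤t))
        (proj₂ (Covers-delete e g (Covers-mono S∪T⊆ cov))))
      where
      S∪T⊆ : S ∪ T ⊆ (S ∪ (T - e)) ∪ ⁅ e ⁆
      S∪T⊆ {x} x∈ with x ≟ e | x∈p∪q⁻ S T x∈
      ... | yes refl | _ = x∈p∪q⁺ (inj₂ (x∈⁅x⁆ e))
      ... | no _ | inj₁ x∈S = x∈p∪q⁺ (inj₁ (x∈p∪q⁺ (inj₁ x∈S)))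
      ... | no x≢e | inj₂ x∈T = x∈p∪q⁺ (inj₁ (x∈p∪q⁺ (inj₂ (x∈p∧x≢y⇒x∈p-y x∈T x≢e))))

  Connected⇒Covers : ∀ {S} → Connected G S → Fin n → ∃ λ (g : Fin 1 → Fin n) → Covers S g
  Connected⇒Covers c v = (λ _ → v) , λ u → zero , c v u

  Connected⇒κ≤ : ∀ {S T} → Fin n → Connected G (S ∪ T) → κ G S ≤ suc ∣ T ∣
  Connected⇒κ≤ {S} {T} v c = subst (κ G S ≤_) (ℕ.+-comm ∣ T ∣ 1)
    (Separated⇒≤∣T∣+Covers (proj₂ (proj₂ (κ-representatives S)))
      (proj₂ (Connected⇒Covers c v)))

  -- Without edges all vertices are separated, so the count is applied to `S = ⊥` and the family
  -- `id`.
  Connected⇒n≤ : ∀ {T} → Fin n → Connected G T → n ≤ suc ∣ T ∣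
  Connected⇒n≤ {T} v c = subst (n ≤_) (ℕ.+-comm ∣ T ∣ 1)
    (Separated⇒≤∣T∣+Covers {S = ⊥} {f = id} Reachable-⊥
      (proj₂ (Connected⇒Covers (Connected-mono (q⊆p∪q ⊥ T) c) v)))

  -- If `g zero` reaches the next representative, one of the two is redundant. Otherwise a path
  -- between them leaves the `S`-component of `g zero` along an edge of `T`, and adding that edge
  -- makes the representative beyond it redundant.
  Covers-merge : ∀ {S T k} (g : Fin (suc (suc k)) → Fin n) → Covers S g → Connected G (S ∪ T) →
                 (∃ λ (h : Fin (suc k) → Fin n) → Covers S h) ⊎
                 (∃ λ e → e ∈ T × ∃ λ (h : Fin (suc k) → Fin n) → Covers (S ∪ ⁅ e ⁆) h)
  Covers-merge {S} {T} g cov c with reachable? G S (g zero) (g (suc zero))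
  ... | yes r = inj₁ (g ∘ suc , cov′)
    where
    cov′ : Covers S (g ∘ suc)
    cov′ u with cov u
    ... | zero , q = zero , ~.trans S (~.sym S r) q
    ... | suc i , q = i , q
  ... | no ¬r with Star-crossing (reachable? G S (g zero)) (c (g zero) (g (suc zero))) ε ¬r
  ... | a , b , (e , e∈ , j) , g₀~a , ¬g₀~b = inj₂ (e , e∈T , g ∘ punchIn i₀ , cov′)
    where
    e∈T : e ∈ T
    e∈T = [ (λ e∈S → contradiction (~.trans S g₀~a ((e , e∈S , j) ◅ ε)) ¬g₀~b) , id ]′
          (x∈p∪q⁻ S T e∈)
    i₀ = proj₁ (cov b)
    -- So `g zero` survives the removal of index `i₀` and can take over its component.
    i₀≢0 : i₀ ≢ zero
    i₀≢0 eq = ¬g₀~b (subst (λ i → Reachable G S (g i) b) eq (proj₂ (cov b)))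
    lift : ∀ {x y} → Reachable G S x y → Reachable G (S ∪ ⁅ e ⁆) x y
    lift = Reachable-mono (p⊆p∪q ⁅ e ⁆)
    via : ∀ {i u} → i₀ ≢ i → Reachable G (S ∪ ⁅ e ⁆) (g i) u →
          ∃ λ l → Reachable G (S ∪ ⁅ e ⁆) (g (punchIn i₀ l)) u
    via {u = u} i₀≢i q = punchOut i₀≢i
      , subst (λ l → Reachable G (S ∪ ⁅ e ⁆) (g l) u) (sym (punchIn-punchOut i₀≢i)) q
    cov′ : Covers (S ∪ ⁅ e ⁆) (g ∘ punchIn i₀)
    cov′ u with cov u
    ... | i , q with i₀ ≟ i
    ... | no i₀≢i = via i₀≢i (lift q)
    -- The detour from `g zero` goes to `a`, across `e` to `b`, back to `g i₀` and on to `u`.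
    ... | yes refl = via i₀≢0
      (lift g₀~a ◅◅ (e , x∈p∪q⁺ (inj₂ (x∈⁅x⁆ e)) , j) ◅
       ~.trans _ (~.sym _ (lift (proj₂ (cov b)))) (lift q))

  -- Each merge lowers `k` by one and spends at most one edge of `T`, until a single vertex covers
  -- everything.
  Covers⇒connecting : ∀ {S T k} {g : Fin k → Fin n} → Fin n → Covers S g → Connected G (S ∪ T) →
                      ∃ λ T′ → T′ ⊆ T × Connected G (S ∪ T′) × suc ∣ T′ ∣ ≤ k
  Covers⇒connecting {k = zero} v cov _ with cov v
  ... | () , _
  Covers⇒connecting {S} {k = suc zero} {g} v cov _ =
    ⊥ , (λ {_} x∈⊥ → contradiction x∈⊥ ∉⊥) , Connected-mono (p⊆p∪q ⊥) S-connected
      , s≤s (ℕ.≤-reflexive (∣⊥∣≡0 m))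
    where
    from-g₀ : ∀ u → Reachable G S (g zero) u
    from-g₀ u with cov u
    ... | zero , r = r
    S-connected : Connected G S
    S-connected u w = ~.trans S (~.sym S (from-g₀ u)) (from-g₀ w)
  Covers⇒connecting {S} {T} {k = suc (suc k)} {g} v cov c =
    [ (λ (_ , cov′) →
        let T′ , T′⊆T , c′ , le = Covers⇒connecting {k = suc k} v cov′ c
        in T′ , (λ {_} → T′⊆T) , c′ , ℕ.m≤n⇒m≤1+n le)
    , (λ (e , e∈T , _ , cov′) →
        let T′ , T′⊆T , c′ , le = Covers⇒connecting {k = suc k} v cov′ (Connected-mono (S∪T⊆ e) c)
        in ⁅ e ⁆ ∪ T′
           , (λ {_} x∈ → [ (λ x∈e → subst (_∈ T) (sym (x∈⁅y⁆⇒x≡y e x∈e)) e∈T) , T′⊆T ]′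
                     (x∈p∪q⁻ ⁅ e ⁆ T′ x∈))
           , subst (Connected G) (∪-assoc S ⁅ e ⁆ T′) c′
           , s≤s (ℕ.≤-trans (∣⁅x⁆∪p∣≤1+∣p∣ e T′) le))
    ]′ (Covers-merge g cov c)
    where
    S∪T⊆ : ∀ e → S ∪ T ⊆ (S ∪ ⁅ e ⁆) ∪ T
    S∪T⊆ e x∈ = [ x∈p∪q⁺ ∘ inj₁ ∘ p⊆p∪q ⁅ e ⁆ , x∈p∪q⁺ ∘ inj₂ ]′ (x∈p∪q⁻ S T x∈)

  κ-connecting : ∀ {S T} → Fin n → Connected G (S ∪ T) →
                 ∃ λ T′ → T′ ⊆ T × Connected G (S ∪ T′) × suc ∣ T′ ∣ ≤ κ G S
  κ-connecting {S} v c = Covers⇒connecting v (proj₁ (proj₂ (κ-representatives S))) c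

  -- Over `S = ⊥` the family `id` covers with `n` members, so the merging uses at most n - 1 edges.
  spanningTree : Fin n → Connected G ⊤ → ∃ λ T → Connected G T × suc ∣ T ∣ ≤ n
  spanningTree v c
    with Covers⇒connecting {S = ⊥} {⊤} {g = id} v (λ u → u , ε) (Connected-mono (q⊆p∪q ⊥ ⊤) c)
  ... | T , _ , c′ , le = T , subst (Connected G) (∪-identityˡ T) c′ , le

-- Two distinct edges of a simple graph on three vertices share exactly one vertex and so touch all
-- three. The claim is transferred from the graph `pair` having just these two edges.
triangle-connected : ∀ {m} (G : Graph 3 m) → Simple G → ∀ {S e f} →
                     e ∈ S → f ∈ S → e ≢ f → Connected G S
triangle-connected G (loopless , unique) {S} {e} {f} e∈S f∈S e≢f u v =
  mapStar (λ { (zero , _ , j) → e , e∈S , j ; (suc zero , _ , j) → f , f∈S , j })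
    (twoEdges (proj₁ (endpoints G e)) (proj₂ (endpoints G e)) (endpoints G f)
      (λ eq → loopless e _ (inj₁ (cong (proj₁ (endpoints G e) ,_) (sym eq))))
      (λ eq → loopless f _ (inj₁ (cong (proj₁ (endpoints G f) ,_) (sym eq))))
      (λ eq → e≢f (unique e f _ _ (inj₁ refl) (inj₁ eq)))
      (λ eq → e≢f (unique e f _ _ (inj₁ refl) (inj₂ eq)))
      u v)
  where
  pair : Fin 3 × Fin 3 → Fin 3 × Fin 3 → Graph 3 2
  pair p q = mkGraph λ { zero → p ; (suc zero) → q }
  twoEdges : ∀ a b (q : Fin 3 × Fin 3) → a ≢ b → proj₁ q ≢ proj₂ q →
             q ≢ (a , b) → q ≢ (b , a) → Connected (pair (a , b) q) ⊤
  -- Only finitely many endpoint choices exist in `Fin 3`, so the decision procedure settles them by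
  -- evaluation.
  twoEdges a b (c , d) = toWitness {a? =
    all? λ a → all? λ b → all? λ c → all? λ d →
      ¬? (a ≟ b) →-dec (¬? (c ≟ d) →-dec
      (¬? (≡-dec _≟_ _≟_ (c , d) (a , b)) →-dec (¬? (≡-dec _≟_ _≟_ (c , d) (b , a)) →-dec
      connected? (pair (a , b) (c , d)) ⊤)))} _ a b c d

-- Wild numbers

wld-≡ : ∀ {n m ℓ k} (G : ConnectedGraph n m) (γ : Coloring G ℓ) →
        (∃ λ W → ColorConnecting G γ W × ∣ W ∣ ≤ k) →
        (∀ W → ColorConnecting G γ W → k ≤ ∣ W ∣) → wld G γ ≡ k
wld-≡ G γ (W , c , W≤k) lower with wildNumber G γ
... | j , (W′ , c′ , refl) , least = ℕ.≤-antisym (ℕ.≤-trans (least (W , c , refl)) W≤k) (lower W′ c′)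

module _ {n m : ℕ} (G : ConnectedGraph n m) (simple : Simple (graph G)) (2<n : 2 < n) where

  private
    vertex : Fin n
    vertex = fromℕ< (ℕ.≤-trans (s≤s z≤n) 2<n)

  1<m : 1 < m
  1<m = ℕ.≤-pred (ℕ.≤-trans 2<n
    (subst (λ k → n ≤ suc k) (∣⊤∣≡n m) (Connected⇒n≤ (graph G) vertex (connected G))))

  monochromatic : ∀ (γ : Coloring G 1) → wld G γ ≡ 0
  monochromatic γ = wld-≡ G γ (⊥ , connecting , ℕ.≤-reflexive (∣⊥∣≡0 m)) λ _ _ → z≤n
    where
    only : (i j : Fin 1) → i ≡ j
    only zero zero = refl
    connecting : ColorConnecting G γ ⊥
    connecting i = Connected-mono (graph G)
      (λ _ → q⊆p∪q ⊥ _ (∈fiber⁺ (Surjection.to γ) (only _ i))) (connected G)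

  bichromatic : ∀ (γ : Coloring G 2) →
    wld G γ ≡ κ (graph G) (colorClass G γ zero) + κ (graph G) (colorClass G γ (suc zero)) ∸ 2
  bichromatic γ = wld-≡ G γ (upper (κ-connecting H vertex E₁∪E₂-connected) (κ-connecting H vertex E₂∪E₁-connected)) lower
    where
    H = graph G
    E₁ = colorClass G γ zero
    E₂ = colorClass G γ (suc zero)
    to = Surjection.to γ
    split : ∀ e → e ∈ E₁ ⊎ e ∈ E₂
    split e with to e in eq
    ... | zero = inj₁ (∈fiber⁺ to eq)
    ... | suc zero = inj₂ (∈fiber⁺ to eq)
    E₁∪E₂-connected : Connected H (E₁ ∪ E₂)
    E₁∪E₂-connected = Connected-mono H (λ {e} _ → x∈p∪q⁺ (split e)) (connected G)
    E₂∪E₁-connected : Connected H (E₂ ∪ E₁)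
    E₂∪E₁-connected = subst (Connected H) (∪-comm E₁ E₂) E₁∪E₂-connected
    upper : (∃ λ T → T ⊆ E₂ × Connected H (E₁ ∪ T) × suc ∣ T ∣ ≤ κ H E₁) →
            (∃ λ T → T ⊆ E₁ × Connected H (E₂ ∪ T) × suc ∣ T ∣ ≤ κ H E₂) →
            ∃ λ W → ColorConnecting G γ W × ∣ W ∣ ≤ κ H E₁ + κ H E₂ ∸ 2
    upper (T₁ , _ , c₁ , le₁) (T₂ , _ , c₂ , le₂) = T₁ ∪ T₂ , connecting , (begin
      ∣ T₁ ∪ T₂ ∣                       ≤⟨ ∣p∪q∣≤∣p∣+∣q∣ T₁ T₂ ⟩
      ∣ T₁ ∣ + ∣ T₂ ∣                   ≡⟨ cong (_∸ 1) (ℕ.+-suc ∣ T₁ ∣ ∣ T₂ ∣) ⟨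
      suc ∣ T₁ ∣ + suc ∣ T₂ ∣ ∸ 2       ≤⟨ ℕ.∸-monoˡ-≤ 2 (ℕ.+-mono-≤ le₁ le₂) ⟩
      κ H E₁ + κ H E₂ ∸ 2               ∎)
      where
      open ℕ.≤-Reasoning
      connecting : ColorConnecting G γ (T₁ ∪ T₂)
      connecting zero = Connected-mono H
        (λ x∈ → x∈p∪q⁺ ([ inj₂ , inj₁ ∘ p⊆p∪q T₂ ]′ (x∈p∪q⁻ E₁ T₁ x∈))) c₁
      connecting (suc zero) = Connected-mono H
        (λ x∈ → x∈p∪q⁺ ([ inj₂ , inj₁ ∘ q⊆p∪q T₁ T₂ ]′ (x∈p∪q⁻ E₂ T₂ x∈))) c₂
    -- Every edge has one of the two colors, so outside `E₁` the set `W` only offers edges of `E₂`.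
    W∪E₁⊆ : ∀ W → W ∪ E₁ ⊆ E₁ ∪ (W ∩ E₂)
    W∪E₁⊆ W {e} e∈ with split e | x∈p∪q⁻ W E₁ e∈
    ... | inj₁ e∈E₁ | _ = p⊆p∪q _ e∈E₁
    ... | _ | inj₂ e∈E₁ = p⊆p∪q _ e∈E₁
    ... | inj₂ e∈E₂ | inj₁ e∈W = q⊆p∪q E₁ _ (x∈p∩q⁺ (e∈W , e∈E₂))
    W∪E₂⊆ : ∀ W → W ∪ E₂ ⊆ E₂ ∪ (W ∩ E₁)
    W∪E₂⊆ W {e} e∈ with split e | x∈p∪q⁻ W E₂ e∈
    ... | inj₂ e∈E₂ | _ = p⊆p∪q _ e∈E₂
    ... | _ | inj₂ e∈E₂ = p⊆p∪q _ e∈E₂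
    ... | inj₁ e∈E₁ | inj₁ e∈W = q⊆p∪q E₂ _ (x∈p∩q⁺ (e∈W , e∈E₁))
    lower : ∀ W → ColorConnecting G γ W → κ H E₁ + κ H E₂ ∸ 2 ≤ ∣ W ∣
    lower W c = begin
      κ H E₁ + κ H E₂ ∸ 2
        ≤⟨ ℕ.∸-monoˡ-≤ 2 (ℕ.+-mono-≤
             (Connected⇒κ≤ H vertex (Connected-mono H (W∪E₁⊆ W) (c zero)))
             (Connected⇒κ≤ H vertex (Connected-mono H (W∪E₂⊆ W) (c (suc zero))))) ⟩
      suc ∣ W ∩ E₂ ∣ + suc ∣ W ∩ E₁ ∣ ∸ 2
        ≡⟨ cong (_∸ 1) (ℕ.+-suc ∣ W ∩ E₂ ∣ ∣ W ∩ E₁ ∣) ⟩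
      ∣ W ∩ E₂ ∣ + ∣ W ∩ E₁ ∣
        ≡⟨ ℕ.+-comm ∣ W ∩ E₂ ∣ _ ⟩
      ∣ W ∩ E₁ ∣ + ∣ W ∩ E₂ ∣
        -- The trailing `0` gives the sum the shape of `∑` unfolded over `Fin 2`.
        ≡⟨ cong (∣ W ∩ E₁ ∣ +_) (ℕ.+-identityʳ _) ⟨
      ∣ W ∩ E₁ ∣ + (∣ W ∩ E₂ ∣ + 0)
        ≡⟨ ∑-fibers to W ⟩
      ∣ W ∣ ∎
      where open ℕ.≤-Reasoning

  -- Colorings with many colors

  module _ {ℓ : ℕ} (γ : Coloring G ℓ) where

    color : Fin m → Fin ℓ
    color = Surjection.to γ

    classes≥2⇒ℓ*2≤m : (∀ i → 2 ≤ ∣ colorClass G γ i ∣) → ℓ * 2 ≤ m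
    classes≥2⇒ℓ*2≤m 2≤ = subst (ℓ * 2 ≤_) (trans (∑-fibers color ⊤) (∣⊤∣≡n m))
      (*≤∑ _ λ i → subst (λ p → 2 ≤ ∣ p ∣) (sym (∩-identityˡ (colorClass G γ i))) (2≤ i))

    n≤1+∣W∣+∣class∣ : ∀ {W} → ColorConnecting G γ W → ∀ i → n ≤ suc (∣ W ∣ + ∣ colorClass G γ i ∣)
    n≤1+∣W∣+∣class∣ {W} c i =
      ℕ.≤-trans (Connected⇒n≤ (graph G) vertex (c i)) (s≤s (∣p∪q∣≤∣p∣+∣q∣ W _))

    -- A color class inside `W` would make `W` itself connected, which takes n - 1 edges. So each of
    -- the `ℓ` classes has an edge in `∁ W`, and these edges are distinct.
    small⇒∣W∣≤m∸ℓ : ∀ {W} → ColorConnecting G γ W → ∣ W ∣ < n ∸ 1 → ∣ W ∣ ≤ m ∸ ℓ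
    small⇒∣W∣≤m∸ℓ {W} c small = ℕ.m+n≤o⇒m≤o∸n ∣ W ∣ (begin
      ∣ W ∣ + ℓ           ≡⟨ ℕ.+-comm ∣ W ∣ ℓ ⟩
      ℓ + ∣ W ∣           ≤⟨ ℕ.+-monoˡ-≤ ∣ W ∣ ℓ≤∣∁W∣ ⟩
      ∣ ∁ W ∣ + ∣ W ∣     ≡⟨ cong (_+ ∣ W ∣) (∣∁p∣≡n∸∣p∣ W) ⟩
      (m ∸ ∣ W ∣) + ∣ W ∣ ≡⟨ ℕ.m∸n+n≡m (∣p∣≤n W) ⟩
      m                   ∎)
      where
      open ℕ.≤-Reasoning
      class⊈W : ∀ i → ¬ (colorClass G γ i ⊆ W)
      class⊈W i ⊆W = ℕ.<⇒≱ small (ℕ.m≤n+o⇒m∸n≤o n 1 (Connected⇒n≤ (graph G) vertex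
        (Connected-mono (graph G) (λ x∈ → [ id , ⊆W ]′ (x∈p∪q⁻ W _ x∈)) (c i))))
      ℓ≤∣∁W∣ : ℓ ≤ ∣ ∁ W ∣
      ℓ≤∣∁W∣ = subst₂ _≤_ (ℕ.*-identityʳ ℓ) (∑-fibers color (∁ W))
        (*≤∑ _ λ i → p⊈q⇒∣∁q∩p∣≥1 (class⊈W i))

    -- Serves both `ℓ ≡ m` and `ℓ ≡ m ∸ 1`: the first hypothesis makes every class have two edges if
    -- `W` is small, and the second forbids that. A spanning tree attains the bound.
    fewExtraEdges⇒wld≡n∸1 : 2 + (m ∸ ℓ) < n → m < ℓ * 2 → wld G γ ≡ n ∸ 1
    fewExtraEdges⇒wld≡n∸1 few m<2ℓ = wld-≡ G γ upper λ W c → ℕ.≮⇒≥ λ small →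
      ℕ.<⇒≱ m<2ℓ (classes≥2⇒ℓ*2≤m λ i →
        -- Cancels `m ∸ ℓ` in (m - ℓ) + 2 ≤ |W| + |Eᵢ| ≤ (m - ℓ) + |Eᵢ|.
        ℕ.+-cancelˡ-≤ (m ∸ ℓ) _ _ (ℕ.≤-trans
          (subst (_≤ (∣ W ∣ + ∣ colorClass G γ i ∣)) (ℕ.+-comm 2 (m ∸ ℓ))
            (ℕ.≤-pred (ℕ.≤-trans few (n≤1+∣W∣+∣class∣ c i))))
          (ℕ.+-monoˡ-≤ _ (small⇒∣W∣≤m∸ℓ c small))))
      where
      upper : ∃ λ W → ColorConnecting G γ W × ∣ W ∣ ≤ n ∸ 1
      upper with spanningTree (graph G) vertex (connected G)
      ... | T , c , le = T , (λ i → Connected-mono (graph G) (p⊆p∪q _) c)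
        , ℕ.m+n≤o⇒m≤o∸n ∣ T ∣ (subst (_≤ n) (ℕ.+-comm 1 ∣ T ∣) le)

    triangle : n ≡ 3 → ℓ < m → m < ℓ * 2 → wld G γ ≡ 1
    triangle refl ℓ<m m<2ℓ with pigeonhole ℓ<m color
    ... | e , f , e<f , same = wld-≡ G γ (⁅ e ⁆ , connecting , ℕ.≤-reflexive (∣⁅x⁆∣≡1 e)) lower
      where
      e∈ : ∀ {i} → e ∈ ⁅ e ⁆ ∪ colorClass G γ i
      e∈ = p⊆p∪q _ (x∈⁅x⁆ e)
      connecting : ColorConnecting G γ ⁅ e ⁆
      -- For the repeated color the second edge is `f`; for any other color it is a preimage of `i`,
      -- distinct from `e` by its color.
      connecting i with color e ≟ i
      ... | yes eq = triangle-connected (graph G) simple e∈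
        (q⊆p∪q ⁅ e ⁆ _ (∈fiber⁺ color (trans (sym same) eq))) (<⇒≢ e<f)
      ... | no ≢i = triangle-connected (graph G) simple e∈
        (q⊆p∪q ⁅ e ⁆ _ (∈fiber⁺ color (Surjection.to∘to⁻ γ i)))
        λ { refl → ≢i (Surjection.to∘to⁻ γ i) }
      lower : ∀ W → ColorConnecting G γ W → 1 ≤ ∣ W ∣
      -- If `W` were empty, each class alone would connect three vertices and so have two edges.
      lower W c = ℕ.≮⇒≥ λ W<1 → ℕ.<⇒≱ m<2ℓ (classes≥2⇒ℓ*2≤m λ i →
        subst (λ k → 2 ≤ k + _) (ℕ.n<1⇒n≡0 W<1) (ℕ.≤-pred (n≤1+∣W∣+∣class∣ c i)))

  -- Extreme numbers of colors

  oneColor-minimum : IsMinimum (Coloring G) 1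
  oneColor-minimum = constant , least
    where
    edge : Fin m
    edge = fromℕ< (ℕ.≤-trans (s≤s z≤n) 1<m)
    constant : Coloring G 1
    constant = mk↠ₛ {to = λ _ → zero} λ { zero → edge , refl }
    least : ∀ {j} → Coloring G j → 1 ≤ j
    least {zero} γ with () ← Surjection.to γ edge
    least {suc j} γ = s≤s z≤n

  -- The identity coloring attains `m`; a section of any other coloring embeds its colors into the
  -- edges.
  m-colors-maximum : IsMaximum (Coloring G) m
  m-colors-maximum = ↠-id _ , λ γ → injective⇒≤ {f = Surjection.to⁻ γ} λ {i} {j} eq →
    trans (sym (Surjection.to∘to⁻ γ i)) (trans (cong (Surjection.to γ) eq) (Surjection.to∘to⁻ γ j))

m<[m∸1]*2 : ∀ {m} → 1 < m ∸ 1 → m < (m ∸ 1) * 2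
m<[m∸1]*2 {suc m} 1<m = begin-strict
  suc m   <⟨ ℕ.+-monoˡ-< m 1<m ⟩
  m + m   ≡⟨ cong (m +_) (ℕ.+-identityʳ m) ⟨
  2 * m   ≡⟨ ℕ.*-comm 2 m ⟩
  m * 2   ∎
  where open ℕ.≤-Reasoning

theorem6p4 : ∀ {n m : ℕ} (G : ConnectedGraph n m) → Simple (graph G) → 2 < n →
    (IsMinimum (Coloring G) 1 × (∀ (γ : Coloring G 1) → wld G γ ≡ 0))
    × (∀ (γ : Coloring G 2) →
    wld G γ ≡ κ (graph G) (colorClass G γ zero) + κ (graph G) (colorClass G γ (suc zero)) ∸ 2)
    × (∀ {ℓ : ℕ} (γ : Coloring G ℓ) → ℓ ≡ m ∸ 1 → 1 < m ∸ 1 →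
    (n ≡ 3 → wld G γ ≡ 1) × (3 < n → wld G γ ≡ n ∸ 1))
    × (IsMaximum (Coloring G) m × (∀ (γ : Coloring G m) → wld G γ ≡ n ∸ 1))
theorem6p4 {n} {m} G simple 2<n =
  (oneColor-minimum G simple 2<n , monochromatic G simple 2<n)
  , bichromatic G simple 2<n
  , (λ { γ refl 1<m∸1 →
         (λ n≡3 → triangle G simple 2<n γ n≡3 (m∸1<m 1<m∸1) (m<[m∸1]*2 1<m∸1))
       , (λ 3<n → fewExtraEdges⇒wld≡n∸1 G simple 2<n γ
                    -- With `ℓ` equal to `m ∸ 1` there is at most one extra edge, so the condition
                    -- on `n` follows from `3 < n`.
                    (ℕ.≤-trans (s≤s (s≤s (s≤s (m∸[m∸1]≤1 m)))) 3<n) (m<[m∸1]*2 1<m∸1)) })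
  , m-colors-maximum G simple 2<n
  , λ γ → fewExtraEdges⇒wld≡n∸1 G simple 2<n γ
      (subst (λ k → 2 + k < n) (sym (ℕ.n∸n≡0 m)) 2<n) m<m*2
  where
  m∸1<m : ∀ {m} → 1 < m ∸ 1 → m ∸ 1 < m
  m∸1<m {suc m} _ = ℕ.≤-refl
  m∸[m∸1]≤1 : ∀ m → m ∸ (m ∸ 1) ≤ 1
  m∸[m∸1]≤1 zero = z≤n
  m∸[m∸1]≤1 (suc m) = ℕ.≤-reflexive (ℕ.m+n∸n≡m 1 m)
  m<m*2 : m < m * 2
  m<m*2 = ℕ.m<m*n m 2 {{>-nonZero (ℕ.<-trans (s≤s z≤n) (1<m G simple 2<n))}} (s≤s (s≤s z≤n))
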